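{- Let $D$ be a finite directed multigraph and let $p$ be a pebble distribution on $V(D)$. Then $D$ is orderable under $p$ if and only if both of the following hold: (1) (balance condition) every vertex $v$ of $D$ satisfies $\mathrm{balance}(D,p,v)\ge 0$; and (2) (sink condition) every nontrivial sink $A$ in $\mathrm{comp}(D)$ contains some vertex $v$ with $\mathrm{balance}(D,p,v)\ge 1$.
   Context: Directed multigraphs may have multiple edges and loops. A pebble distribution on a vertex set $V$ is a function $p:V\to\{0,1,2,\dots\}$. A pebbling move $uv$ (along an edge from $u$ to $v$) is allowed when $u$ currently has at least two pebbles; it removes two pebbles from $u$ and adds one pebble to $v$. A directed multigraph $D$ is orderable under $p$ if some ordering of the edges of $D$ (counted with multiplicity) is a valid sequence of pebbling moves starting from $p$. Writing $\mathrm{indeg}_D(v)$ and $\mathrm{outdeg}_D(v)$ for the indegree and outdegree of $v$ in $D$ counted with multiplicity, $\mathrm{balance}(D,p,v)=p(v)+\mathrm{indeg}_D(v)-2\,\mathrm{outdeg}_D(v)$. The component digraph $\mathrm{comp}(D)$ is obtained by contracting each strongly connected component of $D$ to a single vertex; a sink of $\mathrm{comp}(D)$ is thus a strongly connected component of $D$ with no edge of $D$ leaving it to another component. A strongly connected component is trivial if it consists of a single vertex with indegree and outdegree zero, and nontrivial otherwise. -}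

module Defs where

open import Data.Nat.Base using (ℕ; suc; _∸_) renaming (_≤_ to _≤ₙ_)
open import Data.Integer.Base using (ℤ; +_; _+_; _-_; _*_; _≤_)
open import Data.Fin.Base using (Fin)
open import Data.Fin.Properties using (_≟_)
open import Data.Fin.Subset using (Subset; _∈_; Nonempty; ⁅_⁆)
open import Data.List.Base using (List; []; _∷_; length; filter)
import Data.List.Membership.Propositional as List
open import Data.List.Relation.Binary.Permutation.Propositional using (_↭_)
open import Data.Product.Base using (Σ; ∃-syntax; _×_; _,_; proj₁; proj₂)
open import Data.Vec.Functional using (updateAt)
open import Function.Bundles using (_⇔_)
open import Relation.Binary.Construct.Closure.ReflexiveTransitive using (Star)
open import Relation.Binary.PropositionalEquality.Core using (_≡_; _≢_)
open import Relation.Nullary.Negation.Core using (¬_)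

-- (u , v) is an edge from u to v.
Edge : ℕ → Set
Edge n = Fin n × Fin n

-- The edges form a multiset, listed in an arbitrary order that no notion below
-- depends on. Parallel edges are repeated entries; loops are allowed.
record Multidigraph (n : ℕ) : Set where
  constructor mkMultidigraph
  field
    edges : List (Edge n)

open Multidigraph public

Distribution : ℕ → Set
Distribution n = Fin n → ℕ

-- The two updates are composed, so a loop has net effect -1 on its vertex.
move : ∀ {n} → Distribution n → Edge n → Distribution n
move p (u , v) = updateAt (updateAt p u (_∸ 2)) v suc

data Valid {n : ℕ} : Distribution n → List (Edge n) → Set where
  []  : ∀ {p} → Valid p []
  _∷_ : ∀ {p e es} → 2 ≤ₙ p (proj₁ e) → Valid (move p e) es → Valid p (e ∷ es)

Orderable : ∀ {n} → Multidigraph n → Distribution n → Set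
Orderable D p = ∃[ es ] (es ↭ edges D × Valid p es)

module _ {n : ℕ} (D : Multidigraph n) where

  indeg : Fin n → ℕ
  indeg v = length (filter (λ e → proj₂ e ≟ v) (edges D))

  outdeg : Fin n → ℕ
  outdeg v = length (filter (λ e → proj₁ e ≟ v) (edges D))

  balance : Distribution n → Fin n → ℤ
  balance p v = + p v + + indeg v - + 2 * + outdeg v

  Adjacent : Fin n → Fin n → Set
  Adjacent u v = (u , v) List.∈ edges D

  Reachable : Fin n → Fin n → Set
  Reachable = Star Adjacent

  -- A is an equivalence class of mutual reachability.
  IsStrongComponent : Subset n → Set
  IsStrongComponent A =
    Nonempty A ×
    (∀ u → u ∈ A → ∀ v → v ∈ A ⇔ (Reachable u v × Reachable v u))

  -- The vertices of comp(D).
  Component : Set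
  Component = Σ (Subset n) IsStrongComponent

  -- The adjacency of comp(D). Contraction discards edges inside a component,
  -- hence the requirement that the two components differ as vertex sets.
  CompAdjacent : Component → Component → Set
  CompAdjacent (A , _) (B , _) =
    A ≢ B × ∃[ u ] ∃[ v ] (u ∈ A × v ∈ B × Adjacent u v)

  IsSink : Component → Set
  IsSink A = ∀ B → ¬ CompAdjacent A B

  -- The degrees are those in D, so a lone vertex with an incoming edge or a
  -- loop is a nontrivial component.
  Trivial : Component → Set
  Trivial (A , _) = ∃[ v ] (A ≡ ⁅ v ⁆ × indeg v ≡ 0 × outdeg v ≡ 0)

  Nontrivial : Component → Set
  Nontrivial A = ¬ Trivial A

  BalanceCondition : Distribution n → Set
  BalanceCondition p = ∀ v → + 0 ≤ balance p v

  SinkCondition : Distribution n → Set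
  SinkCondition p =
    ∀ A → IsSink A → Nontrivial A → ∃[ v ] (v ∈ proj₁ A × + 1 ≤ balance p v)

{-# OPTIONS --safe #-}
-- Let b be the balance of D under p; it is the distribution left after any
-- valid ordering of D. Orderings are built from the last move backwards: an
-- edge (u , v) can come last when b v ≥ 1, and its removal lowers b v by 1 and
-- raises b u by 2. The sink condition is equivalent to the statement that the
-- head of every edge reaches a vertex of balance ≥ 1, and this form survives
-- the removal of a suitable (u , v): if v has no out-edge, any edge into v will
-- do; otherwise some z with b z ≥ 1 is reachable from v by a nonempty walk,
-- and either z ≠ v, or (u , v) is taken to close a cycle through v.
-- Conversely, after the last move into a sink component A its target keeps a
-- pebble, because every edge that starts in A also ends in A.
module Submission where

open import Defs
open import Data.Nat.Base using (ℕ; zero; suc; _+_; _*_; _∸_; _≤_; s≤s; z≤n)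
open import Data.Nat.Properties
open import Data.Nat.Solver using (module +-*-Solver)
import Data.Integer.Base as ℤ
import Data.Integer.Properties as ℤ
open import Algebra.Bundles using (module AbelianGroup)
open import Algebra.Properties.Group (AbelianGroup.group ℤ.+-0-abelianGroup)
  using (//-rightDividesˡ; //-rightDividesʳ)
open import Data.Fin.Base using (Fin)
open import Data.Fin.Properties using () renaming (_≟_ to _≟ᶠ_)
open import Data.Fin.Subset using (Subset; _∈_; ⁅_⁆)
open import Data.Fin.Subset.Properties
  using (_∈?_; x∈⁅x⁆; x∈⁅y⁆⇒x≡y; ⊆-antisym)
open import Data.List.Base
  using (List; []; _∷_; [_]; _++_; _∷ʳ_; length; filter; foldl; allFin)
import Data.List.Membership.Propositional as List
open import Data.List.Membership.Propositional.Properties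
  using (∈-filter⁺; ∈-length; ∈-∃++; ∈-allFin)
open import Data.List.Properties using (length-++; filter-++; filter-none)
open import Data.List.Relation.Binary.Permutation.Propositional
  using (_↭_; ↭-refl; ↭-sym; ↭-trans; prep)
open import Data.List.Relation.Binary.Permutation.Propositional.Properties
  using (↭-length; filter-↭; ∈-resp-↭; shift; ++-comm)
open import Data.List.Relation.Unary.All as All using ()
open import Data.List.Relation.Unary.Any using (here; there; any?)
open import Data.Product.Base using (∃-syntax; _×_; _,_; proj₁; proj₂)
open import Data.Sum.Base as Sum using (_⊎_; inj₁; inj₂)
open import Data.Vec.Base as Vec using ()
open import Data.Vec.Functional using (updateAt)
open import Data.Vec.Functional.Properties using (updateAt-updates; updateAt-minimal)
open import Data.Vec.Properties using ([]=⇒lookup; lookup⇒[]=; lookup∘tabulate)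
open import Function.Base using (_∘_)
open import Function.Bundles using (_⇔_; mk⇔; Equivalence)
open import Level using (Level)
open import Relation.Binary.Core using (Rel)
open import Relation.Binary.Definitions using (Reflexive; Transitive; Decidable)
open import Relation.Binary.Construct.Closure.ReflexiveTransitive
  using (Star; ε; _◅_; _◅◅_; map)
open import Relation.Binary.PropositionalEquality hiding ([_])
open import Relation.Nullary using (¬_; yes; no; does; contradiction)
open import Relation.Nullary.Decidable using (map′; _×-dec_; _⊎-dec_; dec-true)
import Relation.Unary as U

private
  variable
    a ℓ : Level
    A : Set a
    n : ℕ

-- Walks

module _ {T : Rel A ℓ} where

  last-step : ∀ {x y z} → T x y → Star T y z → ∃[ w ] (Star T x w × T w z)
  last-step t ε = _ , ε , t
  last-step t (t′ ◅ π) with last-step t′ π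
  ... | w , ρ , t″ = w , t ◅ ρ , t″

  -- Only the end of each step is restricted, so such a walk may start at `v`. It uses no edge into
  -- `v` and therefore survives the removal of one.
  Avoiding : A → Rel A _
  Avoiding v x y = T x y × y ≢ v

  after-last-visit : Decidable {A = A} _≡_ → ∀ v {x z} → Star T x z →
                     Star (Avoiding v) x z ⊎ Star (Avoiding v) v z
  after-last-visit _≟_ v ε = inj₁ ε
  after-last-visit _≟_ v (_◅_ {j = y} t π) with after-last-visit _≟_ v π
  ... | inj₂ ρ = inj₂ ρ
  ... | inj₁ ρ with y ≟ v
  ...   | yes refl = inj₂ ρ
  ...   | no y≢v   = inj₁ ((t , y≢v) ◅ ρ)

avoiding-walk : {T : Rel A ℓ} → Decidable {A = A} _≡_ → ∀ {v z} →
                Star T v z → Star (Avoiding {T = T} v) v z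
avoiding-walk _≟_ π with after-last-visit _≟_ _ π
... | inj₁ ρ = ρ
... | inj₂ ρ = ρ

-- One scan of the list, moving up whenever an entry lies above the current candidate. In a preorder
-- maximality can only mean that whatever lies above `m` is also below it; for reachability this
-- singles out a sink component.
maximal-above : {_≼_ : Rel A ℓ} → Reflexive _≼_ → Transitive _≼_ →
                Decidable _≼_ → ∀ x (ys : List A) →
                ∃[ m ] (x ≼ m × (∀ {y} → y List.∈ ys → m ≼ y → y ≼ m))
maximal-above rfl trns _≼?_ x [] = x , rfl , λ ()
maximal-above rfl trns _≼?_ x (w ∷ ys) with maximal-above rfl trns _≼?_ x ys
... | m , x≼m , max with m ≼? w
...   | yes m≼w = w , trns x≼m m≼w , λ where
          (here refl) _   → rfl
          (there y∈) w≼y → trns (max y∈ (trns m≼w w≼y)) m≼w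
...   | no m⋠w = m , x≼m , λ where
          (here refl) m≼w → contradiction m≼w m⋠w
          (there y∈) m≼y → max y∈ m≼y

comprehension : {P : U.Pred (Fin n) ℓ} → U.Decidable P → Subset n
comprehension P? = Vec.tabulate (does ∘ P?)

module _ {P : U.Pred (Fin n) ℓ} (P? : U.Decidable P) where

  ∈-comprehension⁺ : ∀ {x} → P x → x ∈ comprehension P?
  ∈-comprehension⁺ {x} px =
    lookup⇒[]= x _ (trans (lookup∘tabulate (does ∘ P?) x) (dec-true (P? x) px))

  ∈-comprehension⁻ : ∀ {x} → x ∈ comprehension P? → P x
  ∈-comprehension⁻ {x} x∈
    with P? x | trans (sym (lookup∘tabulate (does ∘ P?) x)) ([]=⇒lookup x∈)
  ... | yes px | _ = px

-- Degrees

inOf outOf : List (Edge n) → Fin n → ℕ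
inOf es = indeg (mkMultidigraph es)
outOf es = outdeg (mkMultidigraph es)

module _ {P : U.Pred A ℓ} (P? : U.Decidable P) where

  count-++ : ∀ xs ys → length (filter P? (xs ++ ys)) ≡
                       length (filter P? xs) + length (filter P? ys)
  count-++ xs ys = trans (cong length (filter-++ P? xs ys)) (length-++ (filter P? xs))

  count-none : ∀ {xs} → (∀ {x} → x List.∈ xs → ¬ P x) → length (filter P? xs) ≡ 0
  count-none none = cong length (filter-none P? (All.tabulate none))

in-∷ : ∀ (e : Edge n) es w → inOf (e ∷ es) w ≡ inOf [ e ] w + inOf es w
in-∷ e es w = count-++ (λ e → proj₂ e ≟ᶠ w) [ e ] es

out-∷ : ∀ (e : Edge n) es w → outOf (e ∷ es) w ≡ outOf [ e ] w + outOf es w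
out-∷ e es w = count-++ (λ e → proj₁ e ≟ᶠ w) [ e ] es

in-hit : ∀ (u v : Fin n) → inOf [ u , v ] v ≡ 1
in-hit u v with v ≟ᶠ v
... | yes _   = refl
... | no v≢v = contradiction refl v≢v

in-miss : ∀ (u : Fin n) {v w} → v ≢ w → inOf [ u , v ] w ≡ 0
in-miss u {v} {w} v≢w with v ≟ᶠ w
... | yes v≡w = contradiction v≡w v≢w
... | no _    = refl

out-hit : ∀ (u v : Fin n) → outOf [ u , v ] u ≡ 1
out-hit u v with u ≟ᶠ u
... | yes _   = refl
... | no u≢u = contradiction refl u≢u

in-positive : ∀ {es : List (Edge n)} {u v} → (u , v) List.∈ es → 1 ≤ inOf es v
in-positive {v = v} e∈ = ∈-length (∈-filter⁺ (λ e → proj₂ e ≟ᶠ v) e∈ refl)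

in-↭ : ∀ {es fs : List (Edge n)} → es ↭ fs → ∀ w → inOf es w ≡ inOf fs w
in-↭ σ w = ↭-length (filter-↭ (λ e → proj₂ e ≟ᶠ w) σ)

out-↭ : ∀ {es fs : List (Edge n)} → es ↭ fs → ∀ w → outOf es w ≡ outOf fs w
out-↭ σ w = ↭-length (filter-↭ (λ e → proj₁ e ≟ᶠ w) σ)

out-zero⊎edge : ∀ (es : List (Edge n)) v →
                outOf es v ≡ 0 ⊎ ∃[ w ] ((v , w) List.∈ es)
out-zero⊎edge es v with any? (λ e → proj₁ e ≟ᶠ v) es
... | yes some with (_ , w) , e∈ , refl ← List.find some = inj₂ (w , e∈)
... | no none = inj₁ (count-none (λ e → proj₁ e ≟ᶠ v) (λ e∈ eq → none (List.lose e∈ eq)))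

remove : ∀ {x : A} {xs} → x List.∈ xs → ∃[ ys ] (xs ↭ x ∷ ys)
remove {x = x} x∈ with ys , zs , refl ← ∈-∃++ x∈ = ys ++ zs , shift x ys zs

-- Playing a sequence of moves

play : Distribution n → List (Edge n) → Distribution n
play = foldl move

-- The hypothesis makes the truncated subtraction in `move` exact. The first of the four cases is
-- the loop, where both updates hit `w`.
move-balance : ∀ (p : Distribution n) {u v} w → 2 ≤ p u →
  move p (u , v) w + 2 * outOf [ u , v ] w ≡ p w + inOf [ u , v ] w
move-balance p {u} {v} w 2≤pu with u ≟ᶠ w | v ≟ᶠ w
... | yes refl | yes refl
  rewrite updateAt-updates w {suc} (updateAt p w (_∸ 2))
        | updateAt-updates w {_∸ 2} p
        | +-comm (p w) 1 = cong suc (m∸n+n≡m 2≤pu)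
... | yes refl | no v≢w
  rewrite updateAt-minimal w v {suc} (updateAt p w (_∸ 2)) (v≢w ∘ sym)
        | updateAt-updates w {_∸ 2} p
        | +-identityʳ (p w) = m∸n+n≡m 2≤pu
... | no u≢w | yes refl
  rewrite updateAt-updates w {suc} (updateAt p u (_∸ 2))
        | updateAt-minimal w u {_∸ 2} p (u≢w ∘ sym)
        | +-identityʳ (p w) = +-comm 1 (p w)
... | no u≢w | no v≢w
  rewrite updateAt-minimal w v {suc} (updateAt p u (_∸ 2)) (v≢w ∘ sym)
        | updateAt-minimal w u {_∸ 2} p (u≢w ∘ sym) = refl

-- The single-move identities add up. The degree counts ignore order, so every valid ordering of the
-- same edges ends in the same distribution, the balance.
play-balance : ∀ {p : Distribution n} {es} → Valid p es → ∀ w →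
               play p es w + 2 * outOf es w ≡ p w + inOf es w
play-balance [] w = refl
play-balance {p = p} {e ∷ es} (2≤ ∷ vs) w = begin
  q + 2 * outOf (e ∷ es) w      ≡⟨ cong (λ k → q + 2 * k) (out-∷ e es w) ⟩
  q + 2 * (o₁ + o)              ≡⟨ solve 3 (λ q o₁ o → q :+ con 2 :* (o₁ :+ o)
                                     := (q :+ con 2 :* o) :+ con 2 :* o₁) refl q o₁ o ⟩
  (q + 2 * o) + 2 * o₁          ≡⟨ cong (_+ 2 * o₁) (play-balance vs w) ⟩
  (move p e w + i) + 2 * o₁     ≡⟨ solve 3 (λ m i k → (m :+ i) :+ k := (m :+ k) :+ i)
                                     refl (move p e w) i (2 * o₁) ⟩
  (move p e w + 2 * o₁) + i     ≡⟨ cong (_+ i) (move-balance p w 2≤) ⟩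
  (p w + inOf [ e ] w) + i      ≡⟨ +-assoc (p w) _ i ⟩
  p w + (inOf [ e ] w + i)      ≡⟨ cong (p w +_) (in-∷ e es w) ⟨
  p w + inOf (e ∷ es) w         ∎
  where
  open ≡-Reasoning
  open +-*-Solver
  q = play (move p e) es w
  o₁ = outOf [ e ] w
  o = outOf es w
  i = inOf es w

valid-∷ʳ : ∀ {p : Distribution n} {es e} → Valid p es → 2 ≤ play p es (proj₁ e) →
           Valid p (es ∷ʳ e)
valid-∷ʳ [] 2≤ = 2≤ ∷ []
valid-∷ʳ (2≤′ ∷ vs) 2≤ = 2≤′ ∷ valid-∷ʳ vs 2≤

-- Balance

-- k ≤ balance, with the outdegree moved across so that it is a statement in ℕ.
record Slack (k : ℕ) (p : Distribution n) (es : List (Edge n)) (v : Fin n) : Set where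
  constructor slack
  field bound : k + 2 * outOf es v ≤ p v + inOf es v

module _ (D : Multidigraph n) (p : Distribution n) {k : ℕ} {v : Fin n} where

  private
    i = indeg D v
    o = outdeg D v

    balance-≡ : balance D p v ≡ ℤ.+ (p v + i) ℤ.- ℤ.+ (2 * o)
    balance-≡ = cong₂ ℤ._-_ (sym (ℤ.pos-+ (p v) i)) (sym (ℤ.pos-* 2 o))

  balance⇒slack : ℤ.+ k ℤ.≤ balance D p v → Slack k p (edges D) v
  balance⇒slack k≤b = slack (ℤ.drop‿+≤+ (subst (ℤ.+ (k + 2 * o) ℤ.≤_)
    (trans (cong (ℤ._+ ℤ.+ (2 * o)) balance-≡) (//-rightDividesˡ (ℤ.+ (2 * o)) (ℤ.+ (p v + i))))
    (ℤ.+-monoˡ-≤ (ℤ.+ (2 * o)) k≤b)))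

  slack⇒balance : Slack k p (edges D) v → ℤ.+ k ℤ.≤ balance D p v
  slack⇒balance (slack s) = subst₂ ℤ._≤_
    (//-rightDividesʳ (ℤ.+ (2 * o)) (ℤ.+ k)) (sym balance-≡)
    (ℤ.+-monoˡ-≤ (ℤ.- ℤ.+ (2 * o)) (ℤ.+≤+ s))

module _ {p : Distribution n} where

  slack-↭ : ∀ {k es fs v} → es ↭ fs → Slack k p es v → Slack k p fs v
  slack-↭ {k} {v = v} σ (slack s) =
    slack (subst₂ (λ o i → k + 2 * o ≤ p v + i) (out-↭ σ v) (in-↭ σ v) s)

  play-slack : ∀ {k es v} → Valid p es → Slack k p es v → k ≤ play p es v
  play-slack {k} {es} {v} vs (slack s) =
    +-cancelʳ-≤ (2 * outOf es v) k _ (≤-trans s (≤-reflexive (sym (play-balance vs v))))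

  slack-play : ∀ {k es v} → Valid p es → k ≤ play p es v → Slack k p es v
  slack-play {k} {es} {v} vs k≤ =
    slack (≤-trans (+-monoˡ-≤ (2 * outOf es v) k≤) (≤-reflexive (play-balance vs v)))

  slack-weaken : ∀ {k es v} → Slack (suc k) p es v → Slack k p es v
  slack-weaken (slack s) = slack (<⇒≤ s)

  -- Dropping `e` changes the balance at `w` by twice its outdegree in `[ e ]` minus its indegree
  -- there. The three lemmas that follow are instances of this.
  slack-tail : ∀ {j k e es w} → j + inOf [ e ] w ≤ k + 2 * outOf [ e ] w →
               Slack k p (e ∷ es) w → Slack j p es w
  slack-tail {j} {k} {e} {es} {w} le (slack s) = slack (+-cancelʳ-≤ i₁ _ _ (begin
    (j + 2 * o) + i₁         ≡⟨ solve 3 (λ j k i → (j :+ k) :+ i := (j :+ i) :+ k) refl j (2 * o) i₁ ⟩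
    (j + i₁) + 2 * o         ≤⟨ +-monoˡ-≤ (2 * o) le ⟩
    (k + 2 * o₁) + 2 * o     ≡⟨ solve 3 (λ k o₁ o → (k :+ con 2 :* o₁) :+ con 2 :* o
                                  := k :+ con 2 :* (o₁ :+ o)) refl k o₁ o ⟩
    k + 2 * (o₁ + o)         ≡⟨ cong (λ o → k + 2 * o) (out-∷ e es w) ⟨
    k + 2 * outOf (e ∷ es) w ≤⟨ s ⟩
    p w + inOf (e ∷ es) w    ≡⟨ cong (p w +_) (in-∷ e es w) ⟩
    p w + (i₁ + i)           ≡⟨ solve 3 (λ p i₁ i → p :+ (i₁ :+ i) := (p :+ i) :+ i₁) refl (p w) i₁ i ⟩
    (p w + i) + i₁           ∎))
    where
    open ≤-Reasoning
    open +-*-Solver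
    o₁ = outOf [ e ] w
    i₁ = inOf [ e ] w
    o = outOf es w
    i = inOf es w

  slack-other : ∀ {k u v es w} → v ≢ w → Slack k p ((u , v) ∷ es) w → Slack k p es w
  slack-other {k} {u} {v} {w = w} v≢w = slack-tail
    (subst (λ i → k + i ≤ k + 2 * outOf [ u , v ] w) (sym (in-miss u v≢w)) (+-monoʳ-≤ k z≤n))

  slack-target : ∀ {k u v es} → Slack (suc k) p ((u , v) ∷ es) v → Slack k p es v
  slack-target {k} {u} {v} = slack-tail
    (subst (λ i → k + i ≤ suc k + 2 * outOf [ u , v ] v) (sym (in-hit u v))
      (≤-trans (≤-reflexive (+-comm k 1)) (m≤m+n (suc k) _)))

  slack-source : ∀ {u v es} → Slack 1 p ((u , v) ∷ es) v → Slack 0 p ((u , v) ∷ es) u →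
                 Slack 2 p es u
  slack-source {u} {v} sv su with u ≟ᶠ v
  ... | yes refl = slack-tail
    (subst₂ (λ i o → 2 + i ≤ 1 + 2 * o) (sym (in-hit u u)) (sym (out-hit u u)) ≤-refl) sv
  ... | no u≢v = slack-tail
    (subst₂ (λ i o → 2 + i ≤ 2 * o) (sym (in-miss u (u≢v ∘ sym))) (sym (out-hit u v)) ≤-refl) su

-- Reachability

Path : List (Edge n) → Rel (Fin n) _
Path es = Reachable (mkMultidigraph es)

path-mono : ∀ {es fs : List (Edge n)} → (∀ {e} → e List.∈ es → e List.∈ fs) →
            ∀ {x y} → Path es x y → Path fs x y
path-mono sub = map sub

-- Keep the walk up to the first use of the new edge and from its last use on. Reachability is then
-- decidable by induction on the edge list, with no bound on the length of walks.
through-new-edge : ∀ {u v : Fin n} {es x y} → Path ((u , v) ∷ es) x y →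
                   Path es x y ⊎ (Path es x u × Path es v y)
through-new-edge ε = inj₁ ε
through-new-edge (here refl ◅ π) with through-new-edge π
... | inj₁ ρ       = inj₂ (ε , ρ)
... | inj₂ (_ , ρ) = inj₂ (ε , ρ)
through-new-edge (there e∈ ◅ π) with through-new-edge π
... | inj₁ ρ       = inj₁ (e∈ ◅ ρ)
... | inj₂ (ρ , σ) = inj₂ (e∈ ◅ ρ , σ)

path? : ∀ (es : List (Edge n)) → Decidable (Path es)
path? [] x y = map′ (λ { refl → ε }) (λ { ε → refl ; (() ◅ _) }) (x ≟ᶠ y)
path? ((u , v) ∷ es) x y =
  map′ Sum.[ path-mono there , (λ (ρ , σ) → path-mono there ρ ◅◅ here refl ◅ path-mono there σ) ]
       through-new-edge
       (path? es x y ⊎-dec (path? es x u ×-dec path? es v y))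

avoiding⇒tail : ∀ {u v : Fin n} {es x y} →
                Star (Avoiding {T = λ x y → (x , y) List.∈ (u , v) ∷ es} v) x y → Path es x y
avoiding⇒tail = map λ where
  (here refl , v≢v) → contradiction refl v≢v
  (there e∈ , _)    → e∈

-- Sufficiency

-- Strong components are not mentioned, because removing an edge may split them.
Supplied : Distribution n → List (Edge n) → Set
Supplied p es = ∀ {x y} → (x , y) List.∈ es → ∃[ z ] (Path es y z × Slack 1 p es z)

supplied-↭ : ∀ {p : Distribution n} {es fs} → es ↭ fs → Supplied p es → Supplied p fs
supplied-↭ σ supplied e∈ with z , π , s ← supplied (∈-resp-↭ (↭-sym σ) e∈) =
  z , path-mono (∈-resp-↭ σ) π , slack-↭ σ s

-- Given balance ≥ 1 at v, this lets an edge into v be played after the rest, es.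
Dispensable : Distribution n → List (Edge n) → Fin n → Set
Dispensable p es v =
  (∀ {x} → ¬ ((x , v) List.∈ es)) ⊎ ∃[ z ] (Path es v z × Slack 1 p es z)

-- A walk that used the removed edge can stop at `u`, which has gained pebbles. Any other walk
-- survives, and its end stays positive unless it is `v`; from `v` the walk is prolonged by `disp`.
-- If instead no edge into `v` is left, no remaining edge can lead to `v`.
supplied-tail : ∀ {p : Distribution n} {u v es} → Slack 1 p ((u , v) ∷ es) v →
                Slack 0 p ((u , v) ∷ es) u →
                Dispensable p es v → Supplied p ((u , v) ∷ es) → Supplied p es
supplied-tail {u = u} {v} sv su disp supplied e∈ with supplied (there e∈)
... | z , π , s with through-new-edge π
...   | inj₂ (ρ , _) = u , ρ , slack-weaken (slack-source sv su)
...   | inj₁ ρ with v ≟ᶠ z | disp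
...     | no v≢z | _ = z , ρ , slack-other v≢z s
...     | yes refl | inj₂ (w , σ , s′) = w , ρ ◅◅ σ , s′
...     | yes refl | inj₁ none = contradiction (proj₂ (proj₂ (last-step e∈ ρ))) none

dispensable-edge : ∀ {p : Distribution n} {e es} → e List.∈ es →
  (∀ v → Slack 0 p es v) → Supplied p es →
  ∃[ u ] ∃[ v ] ∃[ fs ] (es ↭ (u , v) ∷ fs × Slack 1 p es v × Dispensable p fs v)
dispensable-edge {p = p} {es = es} e∈ nonneg supplied
  -- The edge `e∈` followed by `π` is a nonempty walk, so some edge enters the positive vertex `v`.
  with v , π , s ← supplied e∈
  with u , _ , uv∈ ← last-step e∈ π
  with out-zero⊎edge es v
... | inj₁ no-out with fs , σ ← remove uv∈ = u , v , fs , σ , s , disp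
  where
  disp : Dispensable p fs v
  disp with any? (λ e → proj₂ e ≟ᶠ v) fs
  ... | no none = inj₁ λ e∈ → none (List.lose e∈ refl)
  -- Without out-edges, `v` has balance at least its indegree, so one further edge into it lets `v`
  -- supply itself.
  ... | yes some with _ , e∈ , refl ← List.find some = inj₂ (v , ε , slack (begin
    1 + 2 * outOf fs v  ≡⟨ cong (λ o → 1 + 2 * o) (n≤0⇒n≡0 (begin
      outOf fs v                       ≤⟨ m≤n+m _ _ ⟩
      outOf [ u , v ] v + outOf fs v   ≡⟨ out-∷ (u , v) fs v ⟨
      outOf ((u , v) ∷ fs) v           ≡⟨ out-↭ σ v ⟨
      outOf es v                       ≡⟨ no-out ⟩
      0                                ∎)) ⟩
    1                   ≤⟨ in-positive e∈ ⟩
    inOf fs v           ≤⟨ m≤n+m _ (p v) ⟩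
    p v + inOf fs v     ∎))
    where open ≤-Reasoning
... | inj₂ (_ , out∈) with supplied out∈
...   | z , ρ , s′ with v ≟ᶠ z
-- Removing an edge into `v` cannot lower the balance of `z`, and the walk from `v` to `z`, cut
-- after its last visit to `v`, avoids that edge.
...     | no v≢z with fs , σ ← remove uv∈ =
            u , v , fs , σ , s , inj₂ (z ,
              avoiding⇒tail (avoiding-walk _≟ᶠ_ (path-mono (∈-resp-↭ σ) (out∈ ◅ ρ))) ,
              slack-other v≢z (slack-↭ σ s′))
-- The walk returns to `v`. Its last edge is the one to remove: `t` gains pebbles and stays
-- reachable from `v`.
...     | yes refl with t , τ , tv∈ ← last-step out∈ ρ with fs , σ ← remove tv∈ =
            t , v , fs , σ , s , inj₂ (t ,
              avoiding⇒tail (avoiding-walk _≟ᶠ_ (path-mono (∈-resp-↭ σ) τ)) ,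
              slack-weaken (slack-source (slack-↭ σ s) (slack-↭ σ (nonneg t))))

nonneg-tail : ∀ {p : Distribution n} {u v es} → Slack 1 p ((u , v) ∷ es) v →
              (∀ w → Slack 0 p ((u , v) ∷ es) w) → ∀ w → Slack 0 p es w
nonneg-tail {v = v} s nonneg w with v ≟ᶠ w
... | yes refl = slack-target s
... | no v≢w  = slack-other v≢w (nonneg w)

-- The recursion is on the length, since the remaining edges form a tail of `es` only up to
-- permutation.
supplied⇒orderable : ∀ {p : Distribution n} k es → length es ≡ k →
  (∀ v → Slack 0 p es v) → Supplied p es → ∃[ fs ] (fs ↭ es × Valid p fs)
supplied⇒orderable zero [] _ _ _ = [] , ↭-refl , []
supplied⇒orderable {p = p} (suc k) es@(_ ∷ _) len nonneg supplied
  with u , v , fs , σ , s , disp ← dispensable-edge (here refl) nonneg supplied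
  with s′ ← slack-↭ σ s
  with nonneg′ ← (λ w → slack-↭ σ (nonneg w))
  with gs , τ , valid ← supplied⇒orderable k fs
         (suc-injective (trans (sym (↭-length σ)) len))
         (nonneg-tail s′ nonneg′)
         (supplied-tail s′ (nonneg′ u) disp (supplied-↭ σ supplied)) =
  gs ∷ʳ (u , v) ,
  ↭-trans (++-comm gs [ u , v ]) (↭-trans (prep (u , v) τ) (↭-sym σ)) ,
  -- After `gs` the source `u` holds its balance without the last edge, which is at least 2.
  valid-∷ʳ valid (play-slack valid (slack-↭ (↭-sym τ) (slack-source s′ (nonneg′ u))))

-- Strong components

module _ (D : Multidigraph n) where

  private
    _⇝_ = Reachable D
    _⇝?_ = path? (edges D)

  component : Fin n → Component D
  component u = comprehension mutual? , (u , ∈-comprehension⁺ mutual? (ε , ε)) , λ x x∈ y →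
    let (ux , xu) = ∈-comprehension⁻ mutual? x∈ in
    mk⇔ (λ y∈ → let (uy , yu) = ∈-comprehension⁻ mutual? y∈ in xu ◅◅ uy , yu ◅◅ ux)
        (λ (xy , yx) → ∈-comprehension⁺ mutual? (ux ◅◅ xy , yx ◅◅ xu))
    where
    mutual? : U.Decidable (λ v → u ⇝ v × v ⇝ u)
    mutual? v = (u ⇝? v) ×-dec (v ⇝? u)

  ∈-component : ∀ u → u ∈ proj₁ (component u)
  ∈-component u = proj₂ (proj₁ (proj₂ (component u)))

  in-component : (A : Component D) → ∀ {u v} → u ∈ proj₁ A → u ⇝ v → v ⇝ u → v ∈ proj₁ A
  in-component (_ , _ , class) u∈ π ρ = Equivalence.from (class _ u∈ _) (π , ρ)

  strongly-connected : (A : Component D) → ∀ {u v} → u ∈ proj₁ A → v ∈ proj₁ A → u ⇝ v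
  strongly-connected (_ , _ , class) u∈ v∈ = proj₁ (Equivalence.to (class _ u∈ _) v∈)

  overlapping-≡ : (A B : Component D) → ∀ {u} → u ∈ proj₁ A → u ∈ proj₁ B → proj₁ A ≡ proj₁ B
  overlapping-≡ A B u∈A u∈B = ⊆-antisym (sub A B u∈A u∈B) (sub B A u∈B u∈A)
    where
    sub : (A B : Component D) → ∀ {u} → u ∈ proj₁ A → u ∈ proj₁ B →
          ∀ {v} → v ∈ proj₁ A → v ∈ proj₁ B
    sub A B u∈A u∈B v∈A =
      in-component B u∈B (strongly-connected A u∈A v∈A) (strongly-connected A v∈A u∈A)

  -- An edge leaving `A` would join it in `comp(D)` to `component v`, which differs from `A` because
  -- it contains `v`.
  sink-closed : ∀ A → IsSink D A → ∀ {u v} → u ∈ proj₁ A → Adjacent D u v → v ∈ proj₁ A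
  sink-closed A sink {u} {v} u∈A uv with v ∈? proj₁ A
  ... | yes v∈A = v∈A
  ... | no v∉A = contradiction
    ((λ A≡B → v∉A (subst (v ∈_) (sym A≡B) (∈-component v))) , u , v , u∈A , ∈-component v , uv)
    (sink (component v))

  -- Take `m` maximal for reachability above `x`: every vertex reachable from `m` leads back to it,
  -- so no edge leaves its component.
  sink-below : ∀ x → ∃[ m ] (x ⇝ m × IsSink D (component m))
  sink-below x with m , xm , max ← maximal-above {_≼_ = _⇝_} ε _◅◅_ _⇝?_ x (allFin n) =
    m , xm , λ B (A≢B , u , v , u∈A , v∈B , uv) →
      let mv = strongly-connected (component m) (∈-component m) u∈A ◅◅ uv ◅ ε
      in A≢B (overlapping-≡ (component m) B
           (in-component (component m) (∈-component m) mv (max (∈-allFin v) mv)) v∈B)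

  entered⇒nontrivial : ∀ {x y m} → Adjacent D x y → y ⇝ m → Nontrivial D (component m)
  entered⇒nontrivial {m = m} e∈ ym (w , S≡⁅w⁆ , in≡0 , _)
    with refl ← x∈⁅y⁆⇒x≡y w (subst (m ∈_) S≡⁅w⁆ (∈-component m))
    with _ , _ , um ← last-step e∈ ym = n≮0 (subst (1 ≤_) in≡0 (in-positive um))

  sink⇒supplied : ∀ {p} → SinkCondition D p → Supplied p (edges D)
  sink⇒supplied {p} cond {y = y} e∈
    with m , ym , sink ← sink-below y
    with v , v∈ , b ← cond (component m) sink (entered⇒nontrivial e∈ ym) =
      v , ym ◅◅ strongly-connected (component m) (∈-component m) v∈ , balance⇒slack D p b

  -- If no edge ended in `A`, none could start there either, as a sink is closed under edges. Walks
  -- inside `A` would then be empty, leaving a single vertex of degrees zero.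
  nontrivial-sink-entered : ∀ A → IsSink D A → Nontrivial D A →
                            ∃[ e ] (e List.∈ edges D × proj₂ e ∈ proj₁ A)
  nontrivial-sink-entered A@(S , (a , a∈) , _) sink nontrivial
    with any? (λ e → proj₂ e ∈? S) (edges D)
  ... | yes some = List.find some
  ... | no none = contradiction
    (a , ⊆-antisym S⊆⁅a⁆ (λ v∈ → subst (_∈ S) (sym (x∈⁅y⁆⇒x≡y a v∈)) a∈) ,
      count-none (λ e → proj₂ e ≟ᶠ a) (λ e∈ eq → none (List.lose e∈ (subst (_∈ S) (sym eq) a∈))) ,
      count-none (λ e → proj₁ e ≟ᶠ a)
        (λ e∈ eq → none (List.lose e∈ (sink-closed A sink (subst (_∈ S) (sym eq) a∈) e∈))))
    nontrivial
    where
    S⊆⁅a⁆ : ∀ {v} → v ∈ S → v ∈ ⁅ a ⁆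
    S⊆⁅a⁆ {v} v∈ with strongly-connected A a∈ v∈
    ... | ε = x∈⁅x⁆ a
    ... | e∈ ◅ π = contradiction
      (List.lose (proj₂ (proj₂ (last-step e∈ π))) v∈) none

-- Necessity

-- Closure is asked of the listed moves only, so that it passes to the tail; the recursion stops at
-- the last move into `S`.
pebble-remains : ∀ {p : Distribution n} {es} {S : Subset n} → Valid p es →
  (∀ {u v} → (u , v) List.∈ es → u ∈ S → v ∈ S) →
  ∀ {e} → e List.∈ es → proj₂ e ∈ S → ∃[ v ] (v ∈ S × 1 ≤ play p es v)
pebble-remains {p = p} {(u , v) ∷ es} {S} (_ ∷ valid) closed e∈ e∈S
  with any? (λ e → proj₂ e ∈? S) es
... | yes some with _ , e′∈ , e′∈S ← List.find some =
      pebble-remains valid (closed ∘ there) e′∈ e′∈S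
... | no none with e∈
...   | there e∈es = contradiction (List.lose e∈es e∈S) none
-- A later move from `v` would end in `S`, contradicting `none`; so the pebble just placed on `v` is
-- never spent.
...   | here refl = v , e∈S , play-slack valid (slack (begin
  1 + 2 * outOf es v           ≡⟨ cong (λ o → 1 + 2 * o) (count-none (λ e → proj₁ e ≟ᶠ v)
                                    (λ e∈ eq → none (List.lose e∈
                                      (closed (there e∈) (subst (_∈ S) (sym eq) e∈S))))) ⟩
  1                            ≤⟨ s≤s z≤n ⟩
  suc (updateAt p u (_∸ 2) v)  ≡⟨ updateAt-updates v (updateAt p u (_∸ 2)) ⟨
  move p (u , v) v             ≤⟨ m≤m+n _ _ ⟩
  move p (u , v) v + inOf es v ∎))
  where open ≤-Reasoning

theorem2p5 : ∀ (n : ℕ) (D : Multidigraph n) (p : Distribution n) →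
    Orderable D p ⇔ (BalanceCondition D p × SinkCondition D p)
theorem2p5 n D p = mk⇔ necessary sufficient
  where
  necessary : Orderable D p → BalanceCondition D p × SinkCondition D p
  necessary (es , σ , valid) =
    (λ v → slack⇒balance D p (slack-↭ σ (slack-play valid z≤n))) ,
    λ A sink nontrivial →
      let e , e∈ , e∈A = nontrivial-sink-entered D A sink nontrivial
          v , v∈A , 1≤ = pebble-remains valid
            (λ uv∈ u∈A → sink-closed D A sink u∈A (∈-resp-↭ σ uv∈))
            (∈-resp-↭ (↭-sym σ) e∈) e∈A
      in v , v∈A , slack⇒balance D p (slack-↭ σ (slack-play valid 1≤))

  sufficient : BalanceCondition D p × SinkCondition D p → Orderable D p
  sufficient (balanced , sink) =
    supplied⇒orderable _ (edges D) refl (λ v → balance⇒slack D p (balanced v)) (sink⇒supplied D sink)
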